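{- Let $n\ge 1$ and let $s=a_1a_2\cdots a_n$ be a permutation of $[n]$ in one-line form. Then $$td(s)\geq \max_{\gamma}\left\{\frac{\max\{|C(p_t\bar{s}\gamma)-C(\gamma)|,\ |C_{odd}(p_t\bar{s}\gamma)-C_{odd}(\gamma)|,\ |C_{ev}(p_t\bar{s}\gamma)-C_{ev}(\gamma)|\}}{2}\right\},$$ where $\gamma$ ranges over all permutations of $[n]^*=\{0,1,\dots,n\}$.
   Context: $[n]=\{1,\dots,n\}$. A transposition action on a sequence $s=a_1\cdots a_n$ swaps two adjacent blocks: for some $1\le i\le j<k\le n$ it changes $a_1\cdots a_{i-1}\,a_i\cdots a_j\,a_{j+1}\cdots a_k\,a_{k+1}\cdots a_n$ into $a_1\cdots a_{i-1}\,a_{j+1}\cdots a_k\,a_i\cdots a_j\,a_{k+1}\cdots a_n$. The transposition distance $td(s)$ is the minimum number of such actions needed to transform $s$ into $e_n=12\cdots n$. In cycle notation on $[n]^*$, $\bar s=(0~a_1~a_2~\cdots~a_n)$ and $p_t=(n~n-1~\cdots~1~0)$. For a permutation $\pi$, $C(\pi)$, $C_{odd}(\pi)$, $C_{ev}(\pi)$ denote the number of cycles, of cycles of odd length, and of cycles of even length of $\pi$ (fixed points are cycles of length 1). Products of permutations are compositions of maps (right to left). -}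

module Defs where

open import Data.Nat using (ℕ; zero; suc; _≤_; z≤n; s≤s)
open import Data.Nat.Divisibility using (_∣?_)
open import Data.Nat.GeneralisedArithmetic using (iterate)
open import Data.Fin using (Fin; zero; suc; toℕ; fromℕ; inject₁; punchIn)
import Data.Fin.Properties as Fin
open import Data.Fin.Permutation
  using (Permutation′; _⟨$⟩ʳ_; _⟨$⟩ˡ_; _∘ₚ_; id; flip; insert; insert-punchIn; lift₀; reverse; inverseˡ; inverseʳ)
open import Data.Fin.Subset using (Subset; ∣_∣)
import Data.Bool.Properties as Bool
import Data.Vec as Vec
import Data.Vec.Properties as Vec
open import Data.List using (List; []; _∷_; _++_; length; map; filter; deduplicate; allFin; tabulate)
import Data.List.Properties as List
open import Data.List.Membership.Propositional using (_∈_)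
open import Data.List.Membership.Propositional.Properties using (∈-allFin; ∈-tabulate⁺)
open import Data.List.Membership.Propositional.Properties.WithK using (unique∧set⇒bag)
open import Data.List.Relation.Binary.BagAndSetEquality using (∼bag⇒↭)
import Data.List.Relation.Binary.Permutation.Propositional as Perm
open Perm using (_↭_)
open import Data.List.Relation.Unary.Unique.Propositional.Properties using (tabulate⁺; allFin⁺)
open import Data.Product using (∃; _×_; _,_; proj₁; proj₂)
open import Data.Sum using (_⊎_; inj₁; inj₂; [_,_])
open import Function using (mk⇔)
open import Relation.Binary using (DecidableEquality)
open import Relation.Binary.PropositionalEquality
  using (_≡_; refl; sym; trans; cong; subst)
open import Relation.Nullary using (Dec; yes; no; does; ¬?; contradiction)
open import Relation.Nullary.Decidable using (map′; _⊎-dec_)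
open import Relation.Unary using (Decidable)

private
  variable
    A : Set
    k l m n : ℕ

infix 4 _⟶_ _⟶[_]_
infixr 5 _◅_

-- The two swapped blocks x ∷ b and y ∷ c are nonempty, as i ≤ j < k demands.
data _⟶_ {A : Set} : List A → List A → Set where
  swap-blocks : ∀ u x b y c w →
    u ++ (x ∷ b) ++ (y ∷ c) ++ w ⟶ u ++ (y ∷ c) ++ (x ∷ b) ++ w

data _⟶[_]_ {A : Set} : List A → ℕ → List A → Set where
  done : ∀ {xs} → xs ⟶[ 0 ] xs
  _◅_  : ∀ {xs ys zs} → xs ⟶ ys → ys ⟶[ k ] zs → xs ⟶[ suc k ] zs

-- The letter i ∈ {1,…,n} of a sequence is represented by the element i - 1 of Fin n.
oneLine : Permutation′ n → List (Fin n)
oneLine s = tabulate (s ⟨$⟩ʳ_)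

identitySequence : ∀ n → List (Fin n)
identitySequence n = allFin n

private
  split? : {P : List A → List A → Set} → (∀ u v → Dec (P u v)) →
           ∀ xs → Dec (∃ λ u → ∃ λ v → u ++ v ≡ xs × P u v)
  split? P? [] = map′ (λ p → [] , [] , refl , p) (λ { ([] , [] , refl , p) → p }) (P? [] [])
  split? P? (x ∷ xs) = map′
    [ (λ p → [] , x ∷ xs , refl , p) , (λ { (u , v , eq , p) → x ∷ u , v , cong (x ∷_) eq , p }) ]
    (λ { ([] , _ , refl , p) → inj₁ p
       ; (_ ∷ u , v , refl , p) → inj₂ (u , v , refl , p) })
    (P? [] (x ∷ xs) ⊎-dec split? (λ u v → P? (x ∷ u) v) xs)

  split⁺? : {P : A → List A → List A → Set} → (∀ x u v → Dec (P x u v)) →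
            ∀ xs → Dec (∃ λ x → ∃ λ u → ∃ λ v → x ∷ u ++ v ≡ xs × P x u v)
  split⁺? P? [] = no λ { (_ , _ , _ , () , _) }
  split⁺? P? (x ∷ xs) = map′
    (λ { (u , v , eq , p) → x , u , v , cong (x ∷_) eq , p })
    (λ { (_ , u , v , refl , p) → u , v , refl , p })
    (split? (P? x) xs)

  step? : {Q : List A → Set} → Decidable Q → ∀ xs → Dec (∃ λ ys → xs ⟶ ys × Q ys)
  step? Q? xs = map′
    (λ { (u , _ , refl , x , b , _ , refl , y , c , w , refl , q) →
         _ , swap-blocks u x b y c w , q })
    (λ { (_ , swap-blocks u x b y c w , q) →
         u , _ , refl , x , b , _ , refl , y , c , w , refl , q })
    (split? (λ u → split⁺? (λ x b → split⁺? (λ y c w → Q? (u ++ (y ∷ c) ++ (x ∷ b) ++ w)))) xs)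

  steps? : DecidableEquality A → (zs : List A) → ∀ k xs → Dec (xs ⟶[ k ] zs)
  steps? _≟_ zs zero xs = map′ (λ { refl → done }) (λ { done → refl }) (List.≡-dec _≟_ xs zs)
  steps? _≟_ zs (suc k) xs = map′
    (λ { (_ , s , r) → s ◅ r }) (λ { (s ◅ r) → _ , s , r })
    (step? (steps? _≟_ zs k) xs)

  steps-∷ : ∀ {xs ys : List A} x → xs ⟶[ k ] ys → x ∷ xs ⟶[ k ] x ∷ ys
  steps-∷ x done = done
  steps-∷ x (swap-blocks u y b z c w ◅ r) = swap-blocks (x ∷ u) y b z c w ◅ steps-∷ x r

  steps-trans : ∀ {xs ys zs : List A} → xs ⟶[ k ] ys → ys ⟶[ l ] zs → ∃ λ m → xs ⟶[ m ] zs
  steps-trans done r = _ , r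
  steps-trans (s ◅ q) r = _ , s ◅ proj₂ (steps-trans q r)

  ↭⇒steps : {xs ys : List A} → xs ↭ ys → ∃ λ k → xs ⟶[ k ] ys
  ↭⇒steps Perm.refl = 0 , done
  ↭⇒steps (Perm.prep x p) = _ , steps-∷ x (proj₂ (↭⇒steps p))
  ↭⇒steps (Perm.swap {xs = xs} x y p) =
    _ , swap-blocks [] x [] y [] xs ◅ steps-∷ y (steps-∷ x (proj₂ (↭⇒steps p)))
  ↭⇒steps (Perm.trans p q) = steps-trans (proj₂ (↭⇒steps p)) (proj₂ (↭⇒steps q))

  oneLine↭identity : (s : Permutation′ n) → oneLine s ↭ identitySequence n
  oneLine↭identity {n} s = ∼bag⇒↭ (unique∧set⇒bag (tabulate⁺ injective) (allFin⁺ n)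
    (mk⇔ (λ _ → ∈-allFin _)
         (λ _ → subst (_∈ oneLine s) (inverseʳ s) (∈-tabulate⁺ _))))
    where
    injective : ∀ {i j} → s ⟨$⟩ʳ i ≡ s ⟨$⟩ʳ j → i ≡ j
    injective eq = trans (sym (inverseˡ s)) (trans (cong (s ⟨$⟩ˡ_) eq) (inverseˡ s))

sortable : (s : Permutation′ n) → ∃ λ k → oneLine s ⟶[ k ] identitySequence n
sortable s = ↭⇒steps (oneLine↭identity s)

least : {P : ℕ → Set} → Decidable P → ∀ j → P j → ∃ λ m → P m × (∀ k → P k → m ≤ k)
least P? zero p = 0 , p , λ _ _ → z≤n
least P? (suc j) p with P? 0
... | yes p₀ = 0 , p₀ , λ _ _ → z≤n
... | no ¬p₀ with least (λ k → P? (suc k)) j p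
...   | m , pₘ , min = suc m , pₘ , λ
          { zero p₀ → contradiction p₀ ¬p₀
          ; (suc k) pₖ → s≤s (min k pₖ) }

leastSorting : (s : Permutation′ n) →
  ∃ λ d → oneLine s ⟶[ d ] identitySequence n ×
          (∀ k → oneLine s ⟶[ k ] identitySequence n → d ≤ k)
leastSorting {n} s =
  least (λ k → steps? Fin._≟_ (identitySequence n) k (oneLine s)) _ (proj₂ (sortable s))

td : Permutation′ n → ℕ
td s = proj₁ (leastSorting s)

td-reached : (s : Permutation′ n) → oneLine s ⟶[ td s ] identitySequence n
td-reached s = proj₁ (proj₂ (leastSorting s))

td-minimal : (s : Permutation′ n) → ∀ k → oneLine s ⟶[ k ] identitySequence n → td s ≤ k
td-minimal s = proj₂ (proj₂ (leastSorting s))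

infixr 9 _·_

-- Composition from right to left, whereas _∘ₚ_ composes from left to right.
_·_ : Permutation′ m → Permutation′ m → Permutation′ m
π · ρ = ρ ∘ₚ π

-- i ↦ i + 1 for i < n, and n ↦ 0.
rotation : ∀ n → Permutation′ (suc n)
rotation n = insert (fromℕ n) zero id

-- The cycle (b₀ b₁ ⋯ bₙ) on Fin (suc n), where bᵢ = b ⟨$⟩ʳ i.
fullCycle : Permutation′ (suc n) → Permutation′ (suc n)
fullCycle {n} b = b · rotation n · flip b

private
  punchIn-fromℕ : (i : Fin n) → punchIn (fromℕ n) i ≡ inject₁ i
  punchIn-fromℕ zero    = refl
  punchIn-fromℕ (suc i) = cong suc (punchIn-fromℕ i)

  rotation-inject₁ : (i : Fin n) → rotation n ⟨$⟩ʳ inject₁ i ≡ suc i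
  rotation-inject₁ {n} i =
    trans (cong (rotation n ⟨$⟩ʳ_) (sym (punchIn-fromℕ i))) (insert-punchIn (fromℕ n) zero id i)

  rotation-fromℕ : ∀ n → rotation n ⟨$⟩ʳ fromℕ n ≡ zero
  rotation-fromℕ n with fromℕ n Fin.≟ fromℕ n
  ... | yes _ = refl
  ... | no ≢  = contradiction refl ≢

fullCycle-step : (b : Permutation′ (suc n)) (i : Fin n) →
  fullCycle b ⟨$⟩ʳ (b ⟨$⟩ʳ inject₁ i) ≡ b ⟨$⟩ʳ suc i
fullCycle-step {n} b i = cong (b ⟨$⟩ʳ_)
  (trans (cong (rotation n ⟨$⟩ʳ_) (inverseˡ b)) (rotation-inject₁ i))

fullCycle-last : (b : Permutation′ (suc n)) →
  fullCycle b ⟨$⟩ʳ (b ⟨$⟩ʳ fromℕ n) ≡ b ⟨$⟩ʳ zero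
fullCycle-last {n} b = cong (b ⟨$⟩ʳ_)
  (trans (cong (rotation n ⟨$⟩ʳ_) (inverseˡ b)) (rotation-fromℕ n))

-- (0 a₁ a₂ ⋯ aₙ) on {0,…,n} = Fin (suc n); here lift₀ s maps 0 to 0 and i to aᵢ.
bar : Permutation′ n → Permutation′ (suc n)
bar s = fullCycle (lift₀ s)

-- (n n-1 ⋯ 1 0)
pₜ : ∀ n → Permutation′ (suc n)
pₜ n = fullCycle reverse

-- The set of elements of the cycle through i.  Since a cycle on Fin m has length at
-- most m, bounding the exponent k by m loses nothing.
cycleOf : Permutation′ m → Fin m → Subset m
cycleOf {m} π i = Vec.tabulate λ j →
  does (Fin.any? λ (k : Fin m) → iterate (π ⟨$⟩ʳ_) i (toℕ k) Fin.≟ j)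

-- A cycle is represented by its set of elements, so its length is ∣_∣ of that set.
cycles : Permutation′ m → List (Subset m)
cycles {m} π = deduplicate (Vec.≡-dec Bool._≟_) (map (cycleOf π) (allFin m))

C : Permutation′ m → ℕ
C π = length (cycles π)

C-odd : Permutation′ m → ℕ
C-odd π = length (filter (λ c → ¬? (2 ∣? ∣ c ∣)) (cycles π))

C-ev : Permutation′ m → ℕ
C-ev π = length (filter (λ c → 2 ∣? ∣ c ∣) (cycles π))

{-# OPTIONS --safe #-}
module Submission where

-- Swapping the blocks x⋯ and y⋯ in front of z turns the cycle (0 a₁ ⋯ aₙ) into its
-- product with the 3-cycle (x y z), and pₜ is inverse to the cycle of the identity
-- sequence.  So td s multiplications by 3-cycles lead from pₜ s̄ γ to γ, and it is
-- enough that one 3-cycle changes each of C, C-odd and C-ev by at most 2.  Write it as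
-- the product of two transpositions (x y)(z y).  A transposition merges two cycles or
-- splits one, which changes C and C-ev by 1.  It changes C-odd by 0, or by ±2 when an
-- even cycle splits into two odd ones or conversely; then the parity of the length of
-- the cycle of y flips, which keeps both transpositions from changing C-odd in the same
-- direction.

open import Defs
open import Data.Nat using (ℕ; zero; suc; _+_; _*_; _≤_; _<_; _⊔_; ∣_-_∣; s≤s; s≤s⁻¹)
open import Data.Integer using (+_)
open import Data.Rational.Unnormalised using (_/_; *≤*) renaming (_≤_ to _≤ℚ_)
open import Data.Fin.Permutation
  using (Permutation′; _⟨$⟩ʳ_; _⟨$⟩ˡ_; inverseˡ; transpose; lift₀; reverse)
import Data.Bool.Properties as Bool
open import Data.Bool using (true)
open import Data.Fin using (Fin; zero; suc; toℕ; fromℕ; fromℕ<; inject₁; opposite)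
import Data.Fin.Properties as Fin
open import Data.Fin.Subset using (Subset; inside; outside; ∣_∣; _∪_) renaming (_∈_ to _∈ₛ_)
open import Data.Fin.Subset.Properties using (⊆-antisym; x∈p∪q⁺; x∈p∪q⁻)
import Data.Integer as ℤ
import Data.Integer.Properties as ℤ
open import Data.List
  using (List; []; _∷_; _++_; length; map; filter; deduplicate; allFin; tabulate)
open import Data.List.Properties using (++-identityʳ; map-++; map-cong; map-tabulate)
open import Data.List.Membership.Propositional using (_∈_)
open import Data.List.Membership.Propositional.Properties
  using (∈-allFin; ∈-map⁺; ∈-map⁻; ∈-deduplicate⁺; ∈-deduplicate⁻; ∈-filter⁺; ∈-filter⁻)
open import Data.List.Membership.Propositional.Properties.WithK using (unique∧set⇒bag)
open import Data.List.Relation.Binary.BagAndSetEquality using (∼bag⇒↭)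
open import Data.List.Relation.Binary.Permutation.Propositional
  using (_↭_; prep; ↭⇒↭ₛ; module PermutationReasoning)
open import Data.List.Relation.Binary.Permutation.Propositional.Properties
  using (↭-length; filter-↭; shift; shifts; ++⁺ˡ)
import Data.List.Relation.Binary.Permutation.Setoid.Properties as Permₛ
open import Data.List.Relation.Unary.All as All using (All; []; _∷_)
import Data.List.Relation.Unary.All.Properties as All
open import Data.List.Relation.Unary.AllPairs using ([]; _∷_)
open import Data.List.Relation.Unary.Any using (here; there)
open import Data.List.Relation.Unary.Unique.Propositional using (Unique)
open import Data.List.Relation.Unary.Unique.Propositional.Properties
  using (filter⁺; map⁺; tabulate⁺)
import Data.List.Relation.Unary.Unique.DecPropositional.Properties as DecUnique
open import Data.Nat.DivMod using (_%_; m≡m%n+[m/n]*n; m%n<n) renaming (_/_ to _div_)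
open import Data.Nat.Divisibility
  using (_∣_; _∤_; _∣?_; ∣m∣n⇒∣m+n; ∣m+n∣m⇒∣n; ∣-refl; _∣0)
open import Data.Nat.GeneralisedArithmetic using (iterate)
import Data.Nat.Properties as ℕ
open import Data.Product using (∃; _×_; _,_; proj₁; proj₂)
open import Data.Sum as Sum using (_⊎_; inj₁; inj₂; [_,_]′)
open import Data.Vec using ([]; _∷_; here; there)
import Data.Vec.Properties as Vec
open import Function using (_∘_; id; mk⇔)
open import Relation.Binary using (DecidableEquality)
open import Relation.Binary.PropositionalEquality
open import Relation.Nullary using (¬_; Dec; yes; no; does; ¬?; contradiction)
open import Relation.Nullary.Decidable using (dec-true; _⊎-dec_; _×-dec_)
open import Relation.Unary using (Decidable)

private
  variable
    A : Set
    k m n : ℕ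

-- Cycles as orbits

iterate-+ : (f : A → A) (x : A) (a b : ℕ) → iterate f x (a + b) ≡ iterate f (iterate f x a) b
iterate-+ f x zero    b = refl
iterate-+ f x (suc a) b = iterate-+ f (f x) a b

iterate-suc : (f : A → A) (x : A) (k : ℕ) → iterate f x (suc k) ≡ f (iterate f x k)
iterate-suc f x zero    = refl
iterate-suc f x (suc k) = iterate-suc f (f x) k

iterate-* : (f : A → A) (x : A) (p q : ℕ) → iterate f x p ≡ x → iterate f x (q * p) ≡ x
iterate-* f x p zero    eq = refl
iterate-* f x p (suc q) eq = trans (iterate-+ f x p (q * p))
  (trans (cong (λ y → iterate f y (q * p)) eq) (iterate-* f x p q eq))

⟨$⟩ʳ-injective : (π : Permutation′ m) {i j : Fin m} → π ⟨$⟩ʳ i ≡ π ⟨$⟩ʳ j → i ≡ j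
⟨$⟩ʳ-injective π eq = trans (sym (inverseˡ π)) (trans (cong (π ⟨$⟩ˡ_) eq) (inverseˡ π))

iterate-injective : (π : Permutation′ m) (k : ℕ) {i j : Fin m} →
  iterate (π ⟨$⟩ʳ_) i k ≡ iterate (π ⟨$⟩ʳ_) j k → i ≡ j
iterate-injective π zero    eq = eq
iterate-injective π (suc k) eq = ⟨$⟩ʳ-injective π (iterate-injective π k eq)

infix 4 _~[_]_

_~[_]_ : Fin m → Permutation′ m → Fin m → Set
i ~[ π ] j = ∃ λ k → iterate (π ⟨$⟩ʳ_) i k ≡ j

-- Among the `suc m` iterates of `i` with exponents `0` to `m` two coincide; cancelling the earlier
-- exponent by injectivity leaves a return to `i` itself. The bound `p < m` is what the bounded
-- exponents in `cycleOf` require.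
period : (π : Permutation′ m) (i : Fin m) →
  ∃ λ p → p < m × iterate (π ⟨$⟩ʳ_) i (suc p) ≡ i
period {m} π i
  with a , b , a<b , eq ← Fin.pigeonhole (ℕ.n<1+n m) (λ k → iterate (π ⟨$⟩ʳ_) i (toℕ k))
  with p , a+p≡b ← ℕ.m≤n⇒∃[o]m+o≡n a<b
  = p
  , ℕ.≤-trans (s≤s (ℕ.m≤n+m p (toℕ a))) (subst (_≤ m) (sym a+p≡b) (s≤s⁻¹ (Fin.toℕ<n b)))
  , iterate-injective π (toℕ a) (begin
      iterate f (iterate f i (suc p)) (toℕ a) ≡⟨ iterate-+ f i (suc p) (toℕ a) ⟨
      iterate f i (suc p + toℕ a)             ≡⟨ cong (λ k → iterate f i (suc k)) (ℕ.+-comm p _) ⟩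
      iterate f i (suc (toℕ a + p))           ≡⟨ cong (iterate f i) a+p≡b ⟩
      iterate f i (toℕ b)                     ≡⟨ eq ⟨
      iterate f i (toℕ a)                     ∎)
  where
  open ≡-Reasoning
  f = π ⟨$⟩ʳ_

module _ (π : Permutation′ m) where

  ~-refl : ∀ {i} → i ~[ π ] i
  ~-refl = 0 , refl

  ~-trans : ∀ {i j k} → i ~[ π ] j → j ~[ π ] k → i ~[ π ] k
  ~-trans {i} (a , refl) (b , refl) = a + b , iterate-+ (π ⟨$⟩ʳ_) i a b

  ~-step : ∀ i → i ~[ π ] π ⟨$⟩ʳ i
  ~-step i = 1 , refl

  -- A backward step is the rest of the way round the cycle, so nonnegative iterates already give a
  -- symmetric relation.
  ~-step⁻¹ : ∀ i → π ⟨$⟩ʳ i ~[ π ] i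
  ~-step⁻¹ i with p , _ , eq ← period π i = p , eq

  ~-sym : ∀ {i j} → i ~[ π ] j → j ~[ π ] i
  ~-sym     (zero  , refl) = ~-refl
  ~-sym {i} (suc k , eq)   = ~-trans (~-sym (k , eq)) (~-step⁻¹ i)

  -- Reduce the exponent modulo the return time `suc p`.
  ~-bounded : ∀ {i j} p → iterate (π ⟨$⟩ʳ_) i (suc p) ≡ i → i ~[ π ] j →
    ∃ λ k → k ≤ p × iterate (π ⟨$⟩ʳ_) i k ≡ j
  ~-bounded {i} {j} p eq (k , refl) = k % suc p , s≤s⁻¹ (m%n<n k (suc p)) , (begin
    iterate f i (k % suc p)
      ≡⟨ cong (λ y → iterate f y (k % suc p)) (iterate-* f i (suc p) (k div suc p) eq) ⟨
    iterate f (iterate f i (k div suc p * suc p)) (k % suc p)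
      ≡⟨ iterate-+ f i (k div suc p * suc p) (k % suc p) ⟨
    iterate f i (k div suc p * suc p + k % suc p)
      ≡⟨ cong (iterate f i) (trans (ℕ.+-comm _ (k % suc p)) (sym (m≡m%n+[m/n]*n k (suc p)))) ⟩
    iterate f i k ∎)
    where
    open ≡-Reasoning
    f = π ⟨$⟩ʳ_

does⁻ : {P : Set} (P? : Dec P) → does P? ≡ true → P
does⁻ (yes p) _ = p

∈-cycleOf⁻ : (π : Permutation′ m) {i j : Fin m} → j ∈ₛ cycleOf π i → i ~[ π ] j
∈-cycleOf⁻ {m} π {i} {j} j∈
  with k , eq ← does⁻ (Fin.any? λ (k : Fin m) → iterate (π ⟨$⟩ʳ_) i (toℕ k) Fin.≟ j)
    (trans (sym (Vec.lookup∘tabulate _ j)) (Vec.[]=⇒lookup j∈))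
  = toℕ k , eq

∈-cycleOf⁺ : (π : Permutation′ m) {i j : Fin m} → i ~[ π ] j → j ∈ₛ cycleOf π i
∈-cycleOf⁺ π {i} {j} i~j
  with p , p<m , eq ← period π i
  with k , k≤p , eq′ ← ~-bounded π p eq i~j
  = Vec.lookup⇒[]= j _ (trans (Vec.lookup∘tabulate _ j) (dec-true (Fin.any? _)
      (fromℕ< k<m , trans (cong (iterate (π ⟨$⟩ʳ_) i) (Fin.toℕ-fromℕ< k<m)) eq′)))
  where k<m = ℕ.≤-<-trans k≤p p<m

cycleOf-ext : (π ρ : Permutation′ m) {i j : Fin m} →
  (∀ k → i ~[ π ] k → j ~[ ρ ] k) → (∀ k → j ~[ ρ ] k → i ~[ π ] k) →
  cycleOf π i ≡ cycleOf ρ j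
cycleOf-ext π ρ f g = ⊆-antisym
  (∈-cycleOf⁺ ρ ∘ f _ ∘ ∈-cycleOf⁻ π)
  (∈-cycleOf⁺ π ∘ g _ ∘ ∈-cycleOf⁻ ρ)

cycleOf-~ : (π : Permutation′ m) {i j : Fin m} → i ~[ π ] j → cycleOf π i ≡ cycleOf π j
cycleOf-~ π i~j = cycleOf-ext π π (λ _ → ~-trans π (~-sym π i~j)) (λ _ → ~-trans π i~j)

~-cycleOf : (π : Permutation′ m) {i j : Fin m} → cycleOf π i ≡ cycleOf π j → i ~[ π ] j
~-cycleOf π {i} {j} eq = ∈-cycleOf⁻ π (subst (j ∈ₛ_) (sym eq) (∈-cycleOf⁺ π (~-refl π)))

-- Multiplication by a transposition

∣p∪q∣≡∣p∣+∣q∣ : (p q : Subset n) → (∀ {i} → i ∈ₛ p → ¬ i ∈ₛ q) → ∣ p ∪ q ∣ ≡ ∣ p ∣ + ∣ q ∣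
∣p∪q∣≡∣p∣+∣q∣ []            []            _ = refl
∣p∪q∣≡∣p∣+∣q∣ (outside ∷ p) (outside ∷ q) d =
  ∣p∪q∣≡∣p∣+∣q∣ p q λ i∈p i∈q → d (there i∈p) (there i∈q)
∣p∪q∣≡∣p∣+∣q∣ (inside  ∷ p) (outside ∷ q) d =
  cong suc (∣p∪q∣≡∣p∣+∣q∣ p q λ i∈p i∈q → d (there i∈p) (there i∈q))
∣p∪q∣≡∣p∣+∣q∣ (outside ∷ p) (inside  ∷ q) d =
  trans (cong suc (∣p∪q∣≡∣p∣+∣q∣ p q λ i∈p i∈q → d (there i∈p) (there i∈q))) (sym (ℕ.+-suc _ _))
∣p∪q∣≡∣p∣+∣q∣ (inside  ∷ p) (inside  ∷ q) d = contradiction here (d here)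

transpose-cases : (x y v : Fin m) →
  (v ≡ x × transpose x y ⟨$⟩ʳ v ≡ y) ⊎ (v ≡ y × transpose x y ⟨$⟩ʳ v ≡ x) ⊎
  (v ≢ x × v ≢ y × transpose x y ⟨$⟩ʳ v ≡ v)
transpose-cases x y v with v Fin.≟ x
... | yes v≡x = inj₁ (v≡x , refl)
... | no  v≢x with v Fin.≟ y
...   | yes v≡y = inj₂ (inj₁ (v≡y , refl))
...   | no  v≢y = inj₂ (inj₂ (v≢x , v≢y , refl))

transpose-left : (x y : Fin m) → transpose x y ⟨$⟩ʳ x ≡ y
transpose-left x y with transpose-cases x y x
... | inj₁ (_ , eq)                = eq
... | inj₂ (inj₁ (x≡y , eq))       = trans eq x≡y
... | inj₂ (inj₂ (x≢x , _ , _))    = contradiction refl x≢x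

transpose-right : (x y : Fin m) → transpose x y ⟨$⟩ʳ y ≡ x
transpose-right x y with transpose-cases x y y
... | inj₁ (y≡x , eq)              = trans eq y≡x
... | inj₂ (inj₁ (_ , eq))         = eq
... | inj₂ (inj₂ (_ , y≢y , _))    = contradiction refl y≢y

transpose-fixes : {x y v : Fin m} → v ≢ x → v ≢ y → transpose x y ⟨$⟩ʳ v ≡ v
transpose-fixes {x = x} {y} {v} v≢x v≢y with transpose-cases x y v
... | inj₁ (v≡x , _)               = contradiction v≡x v≢x
... | inj₂ (inj₁ (v≡y , _))        = contradiction v≡y v≢y
... | inj₂ (inj₂ (_ , _ , eq))     = eq

transpose-involutive : (x y v : Fin m) → transpose x y ⟨$⟩ʳ (transpose x y ⟨$⟩ʳ v) ≡ v
transpose-involutive x y v with transpose-cases x y v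
... | inj₁ (v≡x , eq)          =
  trans (cong (transpose x y ⟨$⟩ʳ_) eq) (trans (transpose-right x y) (sym v≡x))
... | inj₂ (inj₁ (v≡y , eq))   =
  trans (cong (transpose x y ⟨$⟩ʳ_) eq) (trans (transpose-left x y) (sym v≡y))
... | inj₂ (inj₂ (_ , _ , eq)) =
  trans (cong (transpose x y ⟨$⟩ʳ_) eq) eq

-- The conjugation rule that carries a transposition from the middle of a product to its left end,
-- where `DiffersBy` expects it.
⟨$⟩ʳ-transpose : (π : Permutation′ m) (x y v : Fin m) →
  π ⟨$⟩ʳ (transpose x y ⟨$⟩ʳ v) ≡ transpose (π ⟨$⟩ʳ x) (π ⟨$⟩ʳ y) ⟨$⟩ʳ (π ⟨$⟩ʳ v)
⟨$⟩ʳ-transpose π x y v with transpose-cases x y v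
... | inj₁ (refl , eq)             =
  trans (cong (π ⟨$⟩ʳ_) eq) (sym (transpose-left (π ⟨$⟩ʳ x) (π ⟨$⟩ʳ y)))
... | inj₂ (inj₁ (refl , eq))      =
  trans (cong (π ⟨$⟩ʳ_) eq) (sym (transpose-right (π ⟨$⟩ʳ x) (π ⟨$⟩ʳ y)))
... | inj₂ (inj₂ (v≢x , v≢y , eq)) = trans (cong (π ⟨$⟩ʳ_) eq)
  (sym (transpose-fixes (v≢x ∘ ⟨$⟩ʳ-injective π) (v≢y ∘ ⟨$⟩ʳ-injective π)))

DiffersBy : Fin m → Fin m → Permutation′ m → Permutation′ m → Set
DiffersBy x y π ρ = ∀ i → ρ ⟨$⟩ʳ i ≡ transpose x y ⟨$⟩ʳ (π ⟨$⟩ʳ i)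

differsBy-sym : (π ρ : Permutation′ m) {x y : Fin m} → DiffersBy x y π ρ → DiffersBy x y ρ π
differsBy-sym π ρ {x} {y} d i =
  trans (sym (transpose-involutive x y _)) (cong (transpose x y ⟨$⟩ʳ_) (sym (d i)))

-- Follow the cycle of x under π up to its first return to {x, y}: until then π and
-- its product with the transposition agree, and at that point they part ways.
dichotomy : (π ρ : Permutation′ m) {x y : Fin m} → x ≢ y → DiffersBy x y π ρ →
  (¬ (x ~[ π ] y) × x ~[ ρ ] y) ⊎ (x ~[ π ] y × ¬ (x ~[ ρ ] y))
dichotomy {m} π ρ {x} {y} x≢y d =
  split (least returns? (proj₁ (period π x)) (inj₁ (proj₂ (proj₂ (period π x)))))
  where
  f = π ⟨$⟩ʳ_
  g = ρ ⟨$⟩ʳ_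

  Returns : ℕ → Set
  Returns k = iterate f x (suc k) ≡ x ⊎ iterate f x (suc k) ≡ y

  returns? : ∀ k → Dec (Returns k)
  returns? k = (_ Fin.≟ x) ⊎-dec (_ Fin.≟ y)

  step : ∀ k → iterate g x k ≡ iterate f x k →
    iterate g x (suc k) ≡ transpose x y ⟨$⟩ʳ iterate f x (suc k)
  step k eq = begin
    iterate g x (suc k)                    ≡⟨ iterate-suc g x k ⟩
    g (iterate g x k)                      ≡⟨ cong g eq ⟩
    g (iterate f x k)                      ≡⟨ d _ ⟩
    transpose x y ⟨$⟩ʳ f (iterate f x k)   ≡⟨ cong (transpose x y ⟨$⟩ʳ_) (iterate-suc f x k) ⟨
    transpose x y ⟨$⟩ʳ iterate f x (suc k) ∎
    where open ≡-Reasoning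

  agree : ∀ k → (∀ j → j < k → ¬ Returns j) → iterate g x k ≡ iterate f x k
  agree zero    _     = refl
  agree (suc k) never = trans (step k (agree k λ j j<k → never j (ℕ.m<n⇒m<1+n j<k)))
    (transpose-fixes (never k ℕ.≤-refl ∘ inj₁) (never k ℕ.≤-refl ∘ inj₂))

  split : (∃ λ k → Returns k × (∀ j → Returns j → k ≤ j)) →
    (¬ (x ~[ π ] y) × x ~[ ρ ] y) ⊎ (x ~[ π ] y × ¬ (x ~[ ρ ] y))
  split (k , returns , min) = [ at-x , at-y ]′ returns
    where
    never : ∀ j → j < k → ¬ Returns j
    never j j<k r = ℕ.<⇒≱ j<k (min j r)

    avoids-y : ∀ j → j ≤ k → iterate f x j ≢ y
    avoids-y zero    _   = x≢y
    avoids-y (suc j) j<k = never j j<k ∘ inj₂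

    return-ρ : iterate g x (suc k) ≡ transpose x y ⟨$⟩ʳ iterate f x (suc k)
    return-ρ = step k (agree k never)

    at-x : iterate f x (suc k) ≡ x → _
    -- The `π`-orbit of `x` closes before meeting `y`, while under `ρ` the transposition turns this
    -- return to `x` into an arrival at `y`.
    at-x eq = inj₁
      ( (λ x~y → let j , j≤k , eq′ = ~-bounded π k eq x~y in avoids-y j j≤k eq′)
      , suc k , trans return-ρ (trans (cong (transpose x y ⟨$⟩ʳ_) eq) (transpose-left x y)))

    at-y : iterate f x (suc k) ≡ y → _
    -- Here the roles are exchanged: the `ρ`-orbit closes at `x`, and its points up to then are
    -- those of `π`, none of which is `y`.
    at-y eq = inj₂
      ( (suc k , eq)
      , λ x~y → let j , j≤k , eq′ = ~-bounded ρ k return-x x~y in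
          avoids-y j j≤k (trans (sym (agree j λ i i<j → never i (ℕ.<-≤-trans i<j j≤k))) eq′))
      where
      return-x : iterate g x (suc k) ≡ x
      return-x = trans return-ρ (trans (cong (transpose x y ⟨$⟩ʳ_) eq) (transpose-right x y))

module Joining (π ρ : Permutation′ m) {x y : Fin m}
               (d : DiffersBy x y π ρ) (x~ρy : x ~[ ρ ] y) where

  -- A step of `π` is a step of `ρ` followed by the transposition, which moves points only between
  -- `x` and `y`, hence inside one cycle of `ρ`.
  ~-merge : ∀ {i j} → i ~[ π ] j → i ~[ ρ ] j
  ~-merge     (zero  , refl) = ~-refl ρ
  ~-merge {i} (suc k , eq)   = ~-trans ρ step (~-merge (k , eq))
    where
    step : i ~[ ρ ] π ⟨$⟩ʳ i
    step with transpose-cases x y (ρ ⟨$⟩ʳ i) | differsBy-sym π ρ d i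
    ... | inj₁ (ρi≡x , eq)          | e rewrite trans e eq =
      ~-trans ρ (subst (i ~[ ρ ]_) ρi≡x (~-step ρ i)) x~ρy
    ... | inj₂ (inj₁ (ρi≡y , eq))   | e rewrite trans e eq =
      ~-trans ρ (subst (i ~[ ρ ]_) ρi≡y (~-step ρ i)) (~-sym ρ x~ρy)
    ... | inj₂ (inj₂ (_ , _ , eq))  | e rewrite trans e eq = ~-step ρ i

  Joined : Fin m → Set
  Joined i = x ~[ π ] i ⊎ y ~[ π ] i

  joined-~ : ∀ {i j} → i ~[ π ] j → Joined i → Joined j
  joined-~ i~j (inj₁ x~i) = inj₁ (~-trans π x~i i~j)
  joined-~ i~j (inj₂ y~i) = inj₂ (~-trans π y~i i~j)

  -- A step of `ρ` departs from `π` only where `π` would reach `x` or `y`. It then lands on the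
  -- other of the two, so the walk stays within the union of their `π`-cycles.
  ~-unmerge : ∀ {i j} → i ~[ ρ ] j → i ~[ π ] j ⊎ (Joined i × Joined j)
  ~-unmerge     (zero  , refl) = inj₁ (~-refl π)
  ~-unmerge {i} (suc k , eq) with transpose-cases x y (π ⟨$⟩ʳ i) | d i | ~-unmerge (k , eq)
  ... | inj₁ (πi≡x , e) | e′ | ih = inj₂
    ( inj₁ (~-sym π (subst (i ~[ π ]_) πi≡x (~-step π i)))
    , [ inj₂ ∘ subst (_~[ π ] _) (trans e′ e) , proj₂ ]′ ih)
  ... | inj₂ (inj₁ (πi≡y , e)) | e′ | ih = inj₂
    ( inj₂ (~-sym π (subst (i ~[ π ]_) πi≡y (~-step π i)))
    , [ inj₁ ∘ subst (_~[ π ] _) (trans e′ e) , proj₂ ]′ ih)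
  ... | inj₂ (inj₂ (_ , _ , e)) | e′ | inj₁ ρi~j =
    inj₁ (~-trans π (~-step π i) (subst (_~[ π ] _) (trans e′ e) ρi~j))
  ... | inj₂ (inj₂ (_ , _ , e)) | e′ | inj₂ (joined-ρi , joined-j) = inj₂
    ( joined-~ (~-sym π (~-step π i)) (subst Joined (trans e′ e) joined-ρi) , joined-j)

  joined⇒~ : ∀ {i} → Joined i → y ~[ ρ ] i
  joined⇒~ (inj₁ x~i) = ~-trans ρ (~-sym ρ x~ρy) (~-merge x~i)
  joined⇒~ (inj₂ y~i) = ~-merge y~i

  ~⇒joined : ∀ {i} → y ~[ ρ ] i → Joined i
  ~⇒joined = [ inj₂ , proj₂ ]′ ∘ ~-unmerge

  cycleOf-unjoined : ∀ {i} → ¬ Joined i → cycleOf ρ i ≡ cycleOf π i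
  cycleOf-unjoined ¬joined = cycleOf-ext ρ π
    (λ _ i~k → [ id , (λ j → contradiction (proj₁ j) ¬joined) ]′ (~-unmerge i~k))
    (λ _ → ~-merge)

  cycleOf-joined : cycleOf ρ y ≡ cycleOf π x ∪ cycleOf π y
  cycleOf-joined = ⊆-antisym
    (λ i∈ → x∈p∪q⁺ (Sum.map (∈-cycleOf⁺ π) (∈-cycleOf⁺ π) (~⇒joined (∈-cycleOf⁻ ρ i∈))))
    (λ i∈ → ∈-cycleOf⁺ ρ (joined⇒~ (Sum.map (∈-cycleOf⁻ π) (∈-cycleOf⁻ π)
      (x∈p∪q⁻ (cycleOf π x) (cycleOf π y) i∈))))

  ∣cycleOf-joined∣ : ¬ (x ~[ π ] y) → ∣ cycleOf ρ y ∣ ≡ ∣ cycleOf π x ∣ + ∣ cycleOf π y ∣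
  ∣cycleOf-joined∣ x≁y = trans (cong ∣_∣ cycleOf-joined)
    (∣p∪q∣≡∣p∣+∣q∣ (cycleOf π x) (cycleOf π y) λ i∈x i∈y →
      x≁y (~-trans π (∈-cycleOf⁻ π i∈x) (~-sym π (∈-cycleOf⁻ π i∈y))))

-- The list of cycles when two cycles merge

_≟ˢ_ : DecidableEquality (Subset n)
_≟ˢ_ = Vec.≡-dec Bool._≟_

∈-cycles⁺ : (π : Permutation′ m) (i : Fin m) → cycleOf π i ∈ cycles π
∈-cycles⁺ π i = ∈-deduplicate⁺ _≟ˢ_ (∈-map⁺ (cycleOf π) (∈-allFin i))

∈-cycles⁻ : (π : Permutation′ m) {c : Subset m} → c ∈ cycles π → ∃ λ i → c ≡ cycleOf π i
∈-cycles⁻ {m} π c∈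
  with i , _ , eq ← ∈-map⁻ (cycleOf π) (∈-deduplicate⁻ _≟ˢ_ (map (cycleOf π) (allFin m)) c∈)
  = i , eq

cycles-unique : (π : Permutation′ m) → Unique (cycles π)
cycles-unique π = DecUnique.deduplicate-! _≟ˢ_ _

cycles-cong : (π ρ : Permutation′ m) → (∀ i → π ⟨$⟩ʳ i ≡ ρ ⟨$⟩ʳ i) → cycles π ≡ cycles ρ
cycles-cong {m} π ρ eq =
  cong (deduplicate _≟ˢ_) (map-cong
    (λ i → cycleOf-ext π ρ (λ _ → incl π ρ eq) (λ _ → incl ρ π (sym ∘ eq))) (allFin m))
  where
  incl : (π ρ : Permutation′ m) → (∀ i → π ⟨$⟩ʳ i ≡ ρ ⟨$⟩ʳ i) → ∀ {i j} → i ~[ π ] j → i ~[ ρ ] j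
  incl π ρ eq         (zero  , refl) = ~-refl ρ
  incl π ρ eq {i} {j} (suc k , e)    =
    ~-trans ρ (~-step ρ i) (subst (_~[ ρ ] j) (eq i) (incl π ρ eq (k , e)))

-- With a common `rest`, every count over cycles is compared on just three of them. The lists are
-- taken up to reordering because `cycles` fixes an order that a merge need not respect.
Merges : Fin m → Fin m → Permutation′ m → Permutation′ m → Set
Merges x y π ρ = ∃ λ rest →
  cycles π ↭ cycleOf π x ∷ cycleOf π y ∷ rest ×
  cycles ρ ↭ cycleOf ρ y ∷ rest ×
  ∣ cycleOf ρ y ∣ ≡ ∣ cycleOf π x ∣ + ∣ cycleOf π y ∣

-- Take for `rest` the cycles of `π` other than those of `x` and `y`; they are cycles of `ρ` too.
-- All lists involved are free of repetitions, so having the same members makes them permutations of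
-- each other.
merge : (π ρ : Permutation′ m) {x y : Fin m} → DiffersBy x y π ρ →
  ¬ (x ~[ π ] y) → x ~[ ρ ] y → Merges x y π ρ
merge π ρ {x} {y} d x≁y x~y =
  rest , π↭ , ρ↭ , ∣cycleOf-joined∣ x≁y
  where
  open Joining π ρ d x~y

  X = cycleOf π x
  Y = cycleOf π y

  other? : Decidable λ c → c ≢ X × c ≢ Y
  other? c = ¬? (c ≟ˢ X) ×-dec ¬? (c ≟ˢ Y)

  rest = filter other? (cycles π)

  rest⁻ : ∀ {c} → c ∈ rest → ∃ λ i → c ≡ cycleOf π i × ¬ Joined i
  rest⁻ c∈
    with c∈π , c≢X , c≢Y ← ∈-filter⁻ other? {xs = cycles π} c∈
    with i , refl ← ∈-cycles⁻ π c∈π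
    = i , refl , [ c≢X ∘ sym ∘ cycleOf-~ π , c≢Y ∘ sym ∘ cycleOf-~ π ]′

  rest⁺ : ∀ {i} → ¬ Joined i → cycleOf π i ∈ rest
  rest⁺ {i} ¬joined = ∈-filter⁺ other? (∈-cycles⁺ π i)
    ( ¬joined ∘ inj₁ ∘ ~-sym π ∘ ~-cycleOf π
    , ¬joined ∘ inj₂ ∘ ~-sym π ∘ ~-cycleOf π)

  rest-unique : Unique rest
  rest-unique = filter⁺ other? (cycles-unique π)

  π↭ : cycles π ↭ X ∷ Y ∷ rest
  π↭ = ∼bag⇒↭ (unique∧set⇒bag (cycles-unique π)
    ( All.tabulate (λ
        { (here eq)  X≡c → x≁y (~-cycleOf π (trans X≡c eq))
        ; (there c∈) X≡c → proj₁ (proj₂ (∈-filter⁻ other? {xs = cycles π} c∈)) (sym X≡c) })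
    ∷ All.tabulate (λ c∈ Y≡c → proj₂ (proj₂ (∈-filter⁻ other? {xs = cycles π} c∈)) (sym Y≡c))
    ∷ rest-unique)
    (mk⇔ to λ { (here refl) → ∈-cycles⁺ π x
              ; (there (here refl)) → ∈-cycles⁺ π y
              ; (there (there c∈)) → proj₁ (∈-filter⁻ other? c∈) }))
    where
    to : ∀ {c} → c ∈ cycles π → c ∈ X ∷ Y ∷ rest
    to {c} c∈ with c ≟ˢ X | c ≟ˢ Y
    ... | yes c≡X | _       = here c≡X
    ... | no _    | yes c≡Y = there (here c≡Y)
    ... | no c≢X  | no c≢Y  = there (there (∈-filter⁺ other? c∈ (c≢X , c≢Y)))

  ρ↭ : cycles ρ ↭ cycleOf ρ y ∷ rest
  ρ↭ = ∼bag⇒↭ (unique∧set⇒bag (cycles-unique ρ)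
    -- Every element of the `ρ`-cycle of `y` is joined, but a cycle in `rest` contains an unjoined
    -- one.
    ( All.tabulate (λ c∈ eq → let i , c≡ , ¬joined = rest⁻ c∈ in
        ¬joined (~⇒joined (∈-cycleOf⁻ ρ
          (subst (i ∈ₛ_) (sym (trans eq c≡)) (∈-cycleOf⁺ π (~-refl π))))))
    ∷ rest-unique)
    (mk⇔ to λ { (here refl) → ∈-cycles⁺ ρ y
              ; (there c∈) → from (rest⁻ c∈) }))
    where
    from : ∀ {c} → (∃ λ i → c ≡ cycleOf π i × ¬ Joined i) → c ∈ cycles ρ
    from (i , refl , ¬joined) = subst (_∈ cycles ρ) (cycleOf-unjoined ¬joined) (∈-cycles⁺ ρ i)

    to : ∀ {c} → c ∈ cycles ρ → c ∈ cycleOf ρ y ∷ rest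
    to c∈ with i , refl ← ∈-cycles⁻ ρ c∈ with cycleOf ρ i ≟ˢ cycleOf ρ y
    ... | yes eq = here eq
    ... | no ≢y  = there (subst (_∈ rest) (sym (cycleOf-unjoined ¬joined)) (rest⁺ ¬joined))
      where
      ¬joined : ¬ Joined i
      ¬joined = ≢y ∘ cycleOf-~ ρ ∘ ~-sym ρ ∘ joined⇒~

-- The change of the cycle counts

even⊎odd : ∀ n → (2 ∣ n) ⊎ (2 ∣ suc n)
even⊎odd zero    = inj₁ (2 ∣0)
even⊎odd (suc n) = [ inj₂ ∘ ∣m∣n⇒∣m+n ∣-refl , inj₁ ]′ (even⊎odd n)

odd+odd : ∀ a b → 2 ∤ a → 2 ∤ b → 2 ∣ a + b
odd+odd a b a-odd b-odd with even⊎odd a | even⊎odd b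
... | inj₁ 2∣a  | _         = contradiction 2∣a a-odd
... | inj₂ _    | inj₁ 2∣b  = contradiction 2∣b b-odd
... | inj₂ 2∣1+a | inj₂ 2∣1+b =
  -- `suc a + suc b` is even and equals `2 + (a + b)`; cancel the 2.
  ∣m+n∣m⇒∣n (subst (2 ∣_) (cong suc (ℕ.+-suc a b)) (∣m∣n⇒∣m+n 2∣1+a 2∣1+b)) ∣-refl

record AddParities {A : Set} (Even : A → Set) (x y z : A) : Set where
  field
    ee : Even x → Even y → Even z
    eo : Even x → ¬ Even y → ¬ Even z
    oe : ¬ Even x → Even y → ¬ Even z
    oo : ¬ Even x → ¬ Even y → Even z

-- For an abstract even? the filters below reduce under with-abstraction, which they do
-- not for 2 ∣? ∣ c ∣, whose does computes to an arithmetic test.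
module _ {Even : A → Set} (even? : Decidable Even) (x y z : A) (xs : List A)
         (parities : AddParities Even x y z) where
  open AddParities parities

  -- In the cases `ee`, `eo`, `oe`, `oo` the pair `x`, `y` contributes 2, 1, 1, 0 and `z`
  -- contributes 1, 0, 0, 1.
  count-even : length (filter even? (x ∷ y ∷ xs)) ≡ 1 + length (filter even? (z ∷ xs)) ⊎
               length (filter even? (z ∷ xs)) ≡ 1 + length (filter even? (x ∷ y ∷ xs))
  count-even with even? z
  count-even | yes ez with even? x
  count-even | yes ez | yes ex with even? y
  count-even | yes ez | yes ex | yes ey = inj₁ refl
  count-even | yes ez | yes ex | no oy  = contradiction ez (eo ex oy)
  count-even | yes ez | no ox with even? y
  count-even | yes ez | no ox  | yes ey = contradiction ez (oe ox ey)
  count-even | yes ez | no ox  | no oy  = inj₂ refl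
  count-even | no oz with even? x
  count-even | no oz  | yes ex with even? y
  count-even | no oz  | yes ex | yes ey = contradiction (ee ex ey) oz
  count-even | no oz  | yes ex | no oy  = inj₁ refl
  count-even | no oz  | no ox with even? y
  count-even | no oz  | no ox  | yes ey = inj₁ refl
  count-even | no oz  | no ox  | no oy  = contradiction (oo ox oy) oz

  private
    odd? : Decidable (λ c → ¬ Even c)
    odd? c = ¬? (even? c)

  -- In the cases `ee`, `eo`, `oe`, `oo` the pair contributes 0, 1, 1, 2 and `z` contributes 0, 1,
  -- 1, 0, so only `oo` changes the count.
  count-odd : length (filter odd? (x ∷ y ∷ xs)) ≡ length (filter odd? (z ∷ xs)) ⊎
              (length (filter odd? (x ∷ y ∷ xs)) ≡ 2 + length (filter odd? (z ∷ xs)) ×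
               ¬ Even y × Even z)
  count-odd with even? z
  count-odd | yes ez with even? x
  count-odd | yes ez | yes ex with even? y
  count-odd | yes ez | yes ex | yes ey = inj₁ refl
  count-odd | yes ez | yes ex | no oy  = contradiction ez (eo ex oy)
  count-odd | yes ez | no ox with even? y
  count-odd | yes ez | no ox  | yes ey = contradiction ez (oe ox ey)
  count-odd | yes ez | no ox  | no oy  = inj₂ (refl , oy , ez)
  count-odd | no oz with even? x
  count-odd | no oz  | yes ex with even? y
  count-odd | no oz  | yes ex | yes ey = contradiction (ee ex ey) oz
  count-odd | no oz  | yes ex | no oy  = inj₁ refl
  count-odd | no oz  | no ox with even? y
  count-odd | no oz  | no ox  | yes ey = inj₁ refl
  count-odd | no oz  | no ox  | no oy  = contradiction (oo ox oy) oz

addParities : {c d e : Subset m} → ∣ e ∣ ≡ ∣ c ∣ + ∣ d ∣ → AddParities (λ c → 2 ∣ ∣ c ∣) c d e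
addParities {c = c} {d} {e} size = record
  { ee = λ ec ed → subst (2 ∣_) (sym size) (∣m∣n⇒∣m+n ec ed)
  ; eo = λ ec od ee → od (∣m+n∣m⇒∣n (subst (2 ∣_) size ee) ec)
  ; oe = λ oc ed ee → oc (∣m+n∣m⇒∣n (subst (2 ∣_) (trans size (ℕ.+-comm ∣ c ∣ ∣ d ∣)) ee) ed)
  ; oo = λ oc od → subst (2 ∣_) (sym size) (odd+odd ∣ c ∣ ∣ d ∣ oc od)
  }

C-ev-cycles : (π : Permutation′ m) {cs : List (Subset m)} → cycles π ↭ cs →
  C-ev π ≡ length (filter (λ c → 2 ∣? ∣ c ∣) cs)
C-ev-cycles _ = ↭-length ∘ filter-↭ (λ c → 2 ∣? ∣ c ∣)

C-odd-cycles : (π : Permutation′ m) {cs : List (Subset m)} → cycles π ↭ cs →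
  C-odd π ≡ length (filter (λ c → ¬? (2 ∣? ∣ c ∣)) cs)
C-odd-cycles _ = ↭-length ∘ filter-↭ (λ c → ¬? (2 ∣? ∣ c ∣))

-- The parities at `y` are kept along with the drop because they exclude two drops in succession at
-- the same `y`.
OddDrop : Fin m → Permutation′ m → Permutation′ m → Set
OddDrop y π ρ = C-odd π ≡ 2 + C-odd ρ × 2 ∤ ∣ cycleOf π y ∣ × 2 ∣ ∣ cycleOf ρ y ∣

module _ (π ρ : Permutation′ m) {x y : Fin m} (merges : Merges x y π ρ) where
  private
    rest = proj₁ merges
    π↭   = proj₁ (proj₂ merges)
    ρ↭   = proj₁ (proj₂ (proj₂ merges))
    size = proj₂ (proj₂ (proj₂ merges))
    parities = addParities {c = cycleOf π x} {cycleOf π y} {cycleOf ρ y} size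

  merges-C : C π ≡ 1 + C ρ
  merges-C = trans (↭-length π↭) (cong suc (sym (↭-length ρ↭)))

  merges-C-ev : C-ev π ≡ 1 + C-ev ρ ⊎ C-ev ρ ≡ 1 + C-ev π
  merges-C-ev =
    subst₂ (λ a b → a ≡ 1 + b ⊎ b ≡ 1 + a)
      (sym (C-ev-cycles π π↭)) (sym (C-ev-cycles ρ ρ↭))
      (count-even (λ c → 2 ∣? ∣ c ∣) (cycleOf π x) (cycleOf π y) (cycleOf ρ y) rest parities)

  merges-C-odd : C-odd π ≡ C-odd ρ ⊎ OddDrop y π ρ
  merges-C-odd =
    subst₂ (λ a b → a ≡ b ⊎ (a ≡ 2 + b × 2 ∤ ∣ cycleOf π y ∣ × 2 ∣ ∣ cycleOf ρ y ∣))
      (sym (C-odd-cycles π π↭)) (sym (C-odd-cycles ρ ρ↭))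
      (count-odd (λ c → 2 ∣? ∣ c ∣) (cycleOf π x) (cycleOf π y) (cycleOf ρ y) rest parities)

∣-∣≤ : ∀ k {a b} → a ≡ k + b → ∣ a - b ∣ ≤ k
∣-∣≤ k {a} {b} refl = ℕ.≤-reflexive
  (trans (ℕ.∣-∣-comm (k + b) b) (trans (cong (∣ b -_∣) (ℕ.+-comm k b)) (ℕ.∣m-m+n∣≡n b k)))

∣-∣≤′ : ∀ k {a b} → b ≡ k + a → ∣ a - b ∣ ≤ k
∣-∣≤′ k {a} {b} eq = subst (_≤ k) (ℕ.∣-∣-comm b a) (∣-∣≤ k eq)

module _ (π ρ : Permutation′ m) {x y : Fin m} (x≢y : x ≢ y) (d : DiffersBy x y π ρ) where

  -- A split is a merge with `π` and `ρ` exchanged, since a transposition is its own inverse.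
  merges⊎splits : Merges x y π ρ ⊎ Merges x y ρ π
  merges⊎splits = Sum.map
    (λ (x≁y , x~y) → merge π ρ d x≁y x~y)
    (λ (x~y , x≁y) → merge ρ π (differsBy-sym π ρ d) x≁y x~y)
    (dichotomy π ρ x≢y d)

  transposition-C : ∣ C π - C ρ ∣ ≤ 1
  transposition-C =
    [ ∣-∣≤ 1 ∘ merges-C π ρ , ∣-∣≤′ 1 ∘ merges-C ρ π ]′ merges⊎splits

  transposition-C-ev : ∣ C-ev π - C-ev ρ ∣ ≤ 1
  transposition-C-ev =
    [ [ ∣-∣≤ 1 , ∣-∣≤′ 1 ]′ ∘ merges-C-ev π ρ
    , [ ∣-∣≤′ 1 , ∣-∣≤ 1 ]′ ∘ merges-C-ev ρ π ]′ merges⊎splits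

  transposition-C-odd : C-odd π ≡ C-odd ρ ⊎ OddDrop y π ρ ⊎ OddDrop y ρ π
  transposition-C-odd =
    [ [ inj₁ , inj₂ ∘ inj₁ ]′ ∘ merges-C-odd π ρ
    , [ inj₁ ∘ sym , inj₂ ∘ inj₂ ]′ ∘ merges-C-odd ρ π ]′ merges⊎splits

-- The largest count difference as a pseudometric

distance : Permutation′ m → Permutation′ m → ℕ
distance π ρ = ∣ C π - C ρ ∣ ⊔ (∣ C-odd π - C-odd ρ ∣ ⊔ ∣ C-ev π - C-ev ρ ∣)

distance-lub : (π ρ : Permutation′ m) → ∣ C π - C ρ ∣ ≤ k → ∣ C-odd π - C-odd ρ ∣ ≤ k →
  ∣ C-ev π - C-ev ρ ∣ ≤ k → distance π ρ ≤ k
distance-lub _ _ c o e = ℕ.⊔-lub c (ℕ.⊔-lub o e)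

module _ (π ρ : Permutation′ m) where

  C≤distance : ∣ C π - C ρ ∣ ≤ distance π ρ
  C≤distance = ℕ.m≤m⊔n _ _

  C-odd≤distance : ∣ C-odd π - C-odd ρ ∣ ≤ distance π ρ
  C-odd≤distance = ℕ.m≤n⇒m≤o⊔n ∣ C π - C ρ ∣ (ℕ.m≤m⊔n ∣ C-odd π - C-odd ρ ∣ ∣ C-ev π - C-ev ρ ∣)

  C-ev≤distance : ∣ C-ev π - C-ev ρ ∣ ≤ distance π ρ
  C-ev≤distance = ℕ.m≤n⇒m≤o⊔n ∣ C π - C ρ ∣ (ℕ.m≤n⊔m ∣ C-odd π - C-odd ρ ∣ ∣ C-ev π - C-ev ρ ∣)

distance-triangle : (π σ ρ : Permutation′ m) → distance π ρ ≤ distance π σ + distance σ ρ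
distance-triangle π σ ρ = distance-lub π ρ
  (ℕ.≤-trans (ℕ.∣-∣-triangle (C π) (C σ) (C ρ))
    (ℕ.+-mono-≤ (C≤distance π σ) (C≤distance σ ρ)))
  (ℕ.≤-trans (ℕ.∣-∣-triangle (C-odd π) (C-odd σ) (C-odd ρ))
    (ℕ.+-mono-≤ (C-odd≤distance π σ) (C-odd≤distance σ ρ)))
  (ℕ.≤-trans (ℕ.∣-∣-triangle (C-ev π) (C-ev σ) (C-ev ρ))
    (ℕ.+-mono-≤ (C-ev≤distance π σ) (C-ev≤distance σ ρ)))

distance-cong : (π ρ : Permutation′ m) → (∀ i → π ⟨$⟩ʳ i ≡ ρ ⟨$⟩ʳ i) → distance π ρ ≤ 0
distance-cong π ρ eq = distance-lub π ρ
  (∣-∣≤ 0 (cong length eqs))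
  (∣-∣≤ 0 (cong (length ∘ filter (λ c → ¬? (2 ∣? ∣ c ∣))) eqs))
  (∣-∣≤ 0 (cong (length ∘ filter (λ c → 2 ∣? ∣ c ∣)) eqs))
  where eqs = cycles-cong π ρ eq

-- A change of C-odd toggles the parity of the cycle through y, so two changes in a row
-- cannot go in the same direction.
distance-3-cycle : (π σ ρ : Permutation′ m) {x y z : Fin m} → x ≢ y → z ≢ y →
  DiffersBy z y π σ → DiffersBy x y σ ρ → distance π ρ ≤ 2
distance-3-cycle π σ ρ {y = y} x≢y z≢y d₁ d₂ = distance-lub π ρ
  (ℕ.≤-trans (ℕ.∣-∣-triangle (C π) (C σ) (C ρ)) (ℕ.+-mono-≤
    (transposition-C π σ z≢y d₁) (transposition-C σ ρ x≢y d₂)))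
  (odd (transposition-C-odd π σ z≢y d₁) (transposition-C-odd σ ρ x≢y d₂))
  (ℕ.≤-trans (ℕ.∣-∣-triangle (C-ev π) (C-ev σ) (C-ev ρ)) (ℕ.+-mono-≤
    (transposition-C-ev π σ z≢y d₁) (transposition-C-ev σ ρ x≢y d₂)))
  where
  odd : C-odd π ≡ C-odd σ ⊎ OddDrop y π σ ⊎ OddDrop y σ π →
        C-odd σ ≡ C-odd ρ ⊎ OddDrop y σ ρ ⊎ OddDrop y ρ σ → ∣ C-odd π - C-odd ρ ∣ ≤ 2
  odd (inj₁ p) (inj₁ q) = ℕ.m≤n⇒m≤1+n (ℕ.m≤n⇒m≤1+n (∣-∣≤ 0 (trans p q)))
  odd (inj₁ p) (inj₂ (inj₁ (q , _))) = ∣-∣≤ 2 (trans p q)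
  odd (inj₁ p) (inj₂ (inj₂ (q , _))) = ∣-∣≤′ 2 (trans q (cong (λ a → 2 + a) (sym p)))
  odd (inj₂ (inj₁ (p , _))) (inj₁ q) = ∣-∣≤ 2 (trans p (cong (λ a → 2 + a) q))
  odd (inj₂ (inj₂ (p , _))) (inj₁ q) = ∣-∣≤′ 2 (trans (sym q) p)
  odd (inj₂ (inj₁ (_ , _ , even))) (inj₂ (inj₁ (_ , odd , _))) = contradiction even odd
  odd (inj₂ (inj₂ (_ , odd , _))) (inj₂ (inj₂ (_ , _ , even))) = contradiction even odd
  odd (inj₂ (inj₁ (p , _))) (inj₂ (inj₂ (q , _))) =
    ℕ.m≤n⇒m≤1+n (ℕ.m≤n⇒m≤1+n (∣-∣≤ 0 (trans p (sym q))))
  odd (inj₂ (inj₂ (p , _))) (inj₂ (inj₁ (q , _))) =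
    ℕ.m≤n⇒m≤1+n (ℕ.m≤n⇒m≤1+n (∣-∣≤ 0 (ℕ.+-cancelˡ-≡ 2 (C-odd π) (C-odd ρ) (trans (sym p) q))))

-- Block swaps

-- Path f a xs a says that f has the cycle (a x₁ ⋯ xₖ), for a ∷ xs without repetitions.
Path : (A → A) → A → List A → A → Set
Path f a []       b = f a ≡ b
Path f a (x ∷ xs) b = f a ≡ x × Path f x xs b

path-++⁻ : {f : A → A} {a : A} (xs : List A) {y : A} {ys : List A} {b : A} →
  Path f a (xs ++ y ∷ ys) b → Path f a xs y × Path f y ys b
path-++⁻ []       p       = p
path-++⁻ (x ∷ xs) (e , p) with q , r ← path-++⁻ xs p = (e , q) , r

path-++⁺ : {f : A → A} {a : A} (xs : List A) {y : A} {ys : List A} {b : A} →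
  Path f a xs y → Path f y ys b → Path f a (xs ++ y ∷ ys) b
path-++⁺ []       p       q = p , q
path-++⁺ (x ∷ xs) (e , p) q = e , path-++⁺ xs p q

-- Multiplication on the left acts on the targets of arrows: those in `xs` stay, and only the last
-- arrow is redirected.
path-∘ : {f g : A → A} {a : A} {xs : List A} {b c : A} →
  All (λ x → g x ≡ x) xs → g b ≡ c → Path f a xs b → Path (g ∘ f) a xs c
path-∘ {g = g} []           gb p       = trans (cong g p) gb
path-∘ {g = g} (gx ∷ gxs)   gb (e , p) = trans (cong g e) gx , path-∘ gxs gb p

path-tabulate⁺ : {f : A → A} (g : Fin (suc n) → A) {b : A} →
  (∀ i → f (g (inject₁ i)) ≡ g (suc i)) →
  f (g (fromℕ n)) ≡ b → Path f (g zero) (tabulate (g ∘ suc)) b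
path-tabulate⁺ {n = zero}  g step last = last
path-tabulate⁺ {n = suc n} g step last = step zero , path-tabulate⁺ (g ∘ suc) (step ∘ suc) last

path-tabulate⁻ : {f : A → A} (g : Fin (suc n) → A) {b : A} →
  Path f (g zero) (tabulate (g ∘ suc)) b →
  (∀ i → f (g (inject₁ i)) ≡ g (suc i)) × f (g (fromℕ n)) ≡ b
path-tabulate⁻ {n = zero}  g p = (λ ()) , p
path-tabulate⁻ {n = suc n} g (e , p) with step , last ← path-tabulate⁻ (g ∘ suc) p =
  (λ { zero → e ; (suc i) → step i }) , last

-- Block swaps as 3-cycles

rotate : (x y z : Fin m) → Permutation′ m
rotate x y z = transpose x y · transpose z y

module _ {x y z : Fin m} (x≢y : x ≢ y) (z≢y : z ≢ y) (z≢x : z ≢ x) where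

  rotate-x : rotate x y z ⟨$⟩ʳ x ≡ y
  rotate-x =
    trans (cong (transpose x y ⟨$⟩ʳ_) (transpose-fixes (z≢x ∘ sym) x≢y)) (transpose-left x y)

  rotate-y : rotate x y z ⟨$⟩ʳ y ≡ z
  rotate-y =
    trans (cong (transpose x y ⟨$⟩ʳ_) (transpose-right z y)) (transpose-fixes z≢x z≢y)

  rotate-z : rotate x y z ⟨$⟩ʳ z ≡ x
  rotate-z =
    trans (cong (transpose x y ⟨$⟩ʳ_) (transpose-left z y)) (transpose-right x y)

rotate-fixes : {x y z v : Fin m} → v ≢ x → v ≢ y → v ≢ z → rotate x y z ⟨$⟩ʳ v ≡ v
rotate-fixes {x = x} {y} v≢x v≢y v≢z =
  trans (cong (transpose x y ⟨$⟩ʳ_) (transpose-fixes v≢z v≢y)) (transpose-fixes v≢x v≢y)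

step-↭ : {xs ys : List A} → xs ⟶ ys → xs ↭ ys
step-↭ (swap-blocks u x b y c w) = ++⁺ˡ u (shifts (x ∷ b) (y ∷ c))

step-map : {B : Set} (f : A → B) {xs ys : List A} → xs ⟶ ys → map f xs ⟶ map f ys
step-map f (swap-blocks u x b y c w)
  rewrite map-++ f u (x ∷ b ++ y ∷ c ++ w) | map-++ f b (y ∷ c ++ w) | map-++ f c w
        | map-++ f u (y ∷ c ++ x ∷ b ++ w) | map-++ f c (x ∷ b ++ w) | map-++ f b w
  = swap-blocks (map f u) (f x) (map f b) (f y) (map f c) (map f w)

unique-resp-↭ : {xs ys : List A} → xs ↭ ys → Unique xs → Unique ys
unique-resp-↭ {A} p = Permₛ.Unique-resp-↭ (setoid A) (↭⇒↭ₛ p)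

-- With the block heads in front, `Unique` displays at once that they differ from each other and
-- from everything else; `shift₃` serves the same purpose.
shift₂ : (us vs ws : List A) {x y : A} → us ++ x ∷ vs ++ y ∷ ws ↭ x ∷ y ∷ us ++ vs ++ ws
shift₂ us vs ws {x} {y} = begin
  us ++ x ∷ vs ++ y ∷ ws   ↭⟨ shift x us _ ⟩
  x ∷ us ++ vs ++ y ∷ ws   ↭⟨ prep x (++⁺ˡ us (shift y vs ws)) ⟩
  x ∷ us ++ y ∷ vs ++ ws   ↭⟨ prep x (shift y us _) ⟩
  x ∷ y ∷ us ++ vs ++ ws   ∎
  where open PermutationReasoning

shift₃ : (us vs ws ts : List A) {x y z : A} →
  us ++ x ∷ vs ++ y ∷ ws ++ z ∷ ts ↭ x ∷ y ∷ z ∷ us ++ vs ++ ws ++ ts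
shift₃ us vs ws ts {x} {y} {z} = begin
  us ++ x ∷ vs ++ y ∷ ws ++ z ∷ ts   ↭⟨ shift₂ us vs _ ⟩
  x ∷ y ∷ us ++ vs ++ ws ++ z ∷ ts   ↭⟨ prep x (prep y (++⁺ˡ us (++⁺ˡ vs (shift z ws ts)))) ⟩
  x ∷ y ∷ us ++ vs ++ z ∷ ws ++ ts   ↭⟨ prep x (prep y (++⁺ˡ us (shift z vs _))) ⟩
  x ∷ y ∷ us ++ z ∷ vs ++ ws ++ ts   ↭⟨ prep x (prep y (shift z us _)) ⟩
  x ∷ y ∷ z ∷ us ++ vs ++ ws ++ ts   ∎
  where open PermutationReasoning

unique-rotate-fixes : {x y z : Fin m} {vs : List (Fin m)} → Unique (x ∷ y ∷ z ∷ vs) →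
  All (λ v → rotate x y z ⟨$⟩ʳ v ≡ v) vs
unique-rotate-fixes ((_ ∷ _ ∷ x#) ∷ (_ ∷ y#) ∷ z# ∷ _) = All.zipWith
  (λ { (x≢v , y≢v , z≢v) → rotate-fixes (x≢v ∘ sym) (y≢v ∘ sym) (z≢v ∘ sym) })
  (x# , All.zip (y# , z#))

BlockSwapped : Permutation′ m → Fin m → List (Fin m) → Set
BlockSwapped f a ys = ∃ λ x → ∃ λ y → ∃ λ z →
  x ≢ y × z ≢ y × Path (rotate x y z · f ⟨$⟩ʳ_) a ys a

-- Cut the cycle into the segments `a ∷ u`, `x ∷ b`, `y ∷ c`, `z ∷ w`. The arrows leaving the first
-- three lead to `x`, `y`, `z`; after the 3-cycle they lead to `y`, `z`, `x`, which is the order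
-- after the swap.
swap-blocks-path : (f : Permutation′ m) {a : Fin m} {xs ys : List (Fin m)} → xs ⟶ ys →
  Unique (a ∷ xs) → Path (f ⟨$⟩ʳ_) a xs a → BlockSwapped f a ys
-- When the second block ends the sequence, the next element on the cycle is the start `a`, which
-- takes the role of `z`.
swap-blocks-path f {a} (swap-blocks u x b y c []) uniq p
  rewrite ++-identityʳ c | ++-identityʳ b
  with pu , p′ ← path-++⁻ u p
  with pb , pc ← path-++⁻ b p′
  with uniq′@((x≢y ∷ x≢a ∷ _) ∷ (y≢a ∷ _) ∷ _) ← unique-resp-↭ (shift₂ (a ∷ u) b c) uniq
  with fu , fbc ← All.++⁻ u (unique-rotate-fixes uniq′)
  with fb , fc ← All.++⁻ b fbc
  = x , y , a , x≢y , y≢a ∘ sym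
  , path-++⁺ u (path-∘ fu (rotate-x x≢y (y≢a ∘ sym) (x≢a ∘ sym)) pu)
      (path-++⁺ c (path-∘ fc (rotate-z x≢y (y≢a ∘ sym) (x≢a ∘ sym)) pc)
                  (path-∘ fb (rotate-y x≢y (y≢a ∘ sym) (x≢a ∘ sym)) pb))
swap-blocks-path f {a} (swap-blocks u x b y c (z ∷ w)) uniq p
  with pu , p′ ← path-++⁻ u p
  with pb , p″ ← path-++⁻ b p′
  with pc , pw ← path-++⁻ c p″
  with uniq′@((x≢y ∷ x≢z ∷ _) ∷ (y≢z ∷ _) ∷ _) ← unique-resp-↭ (shift₃ (a ∷ u) b c w) uniq
  -- Here `a` is fixed by the 3-cycle, so the closing arrow out of `z ∷ w` still ends at `a`.
  with fa ∷ fubcw ← unique-rotate-fixes uniq′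
  with fu , fbcw ← All.++⁻ u fubcw
  with fb , fcw ← All.++⁻ b fbcw
  with fc , fw ← All.++⁻ c fcw
  = x , y , z , x≢y , y≢z ∘ sym
  , path-++⁺ u (path-∘ fu (rotate-x x≢y (y≢z ∘ sym) (x≢z ∘ sym)) pu)
      (path-++⁺ c (path-∘ fc (rotate-z x≢y (y≢z ∘ sym) (x≢z ∘ sym)) pc)
      (path-++⁺ b (path-∘ fb (rotate-y x≢y (y≢z ∘ sym) (x≢z ∘ sym)) pb)
                  (path-∘ fw fa pw)))

-- Moved past `p`, the 3-cycle becomes two left multiplications by transpositions of the images
-- under `p`, both involving the image of `y`.
distance-rotate : (p f γ : Permutation′ m) {x y z : Fin m} → x ≢ y → z ≢ y →
  distance (p · f · γ) (p · (rotate x y z · f) · γ) ≤ 2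
distance-rotate p f γ {x} {y} {z} x≢y z≢y =
  distance-3-cycle (p · f · γ) (p · (transpose z y · f) · γ) (p · (rotate x y z · f) · γ)
    (x≢y ∘ ⟨$⟩ʳ-injective p) (z≢y ∘ ⟨$⟩ʳ-injective p)
    (λ i → ⟨$⟩ʳ-transpose p z y _) (λ i → ⟨$⟩ʳ-transpose p x y _)

-- Induction along the sorting sequence, with the cycle of `f` through `a ∷ xs` as invariant and a
-- cost of 2 per action. At `zs` the factor `p` cancels `f`, leaving `γ`. The permutation `f` is
-- general because later stages are known only as products with 3-cycles.
distance-sorting : (p γ : Permutation′ m) {a : Fin m} {xs zs : List (Fin m)} →
  (∀ f → Path (f ⟨$⟩ʳ_) a zs a → ∀ i → p ⟨$⟩ʳ (f ⟨$⟩ʳ i) ≡ i) →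
  xs ⟶[ k ] zs → (f : Permutation′ m) → Unique (a ∷ xs) → Path (f ⟨$⟩ʳ_) a xs a →
  distance (p · f · γ) γ ≤ k * 2
distance-sorting p γ inverse done f _ path =
  distance-cong (p · f · γ) γ (λ i → inverse f path (γ ⟨$⟩ʳ i))
distance-sorting p γ {a} inverse (step ◅ steps) f uniq path
  with x , y , z , x≢y , z≢y , path′ ← swap-blocks-path f step uniq path
  = ℕ.≤-trans (distance-triangle (p · f · γ) (p · (rotate x y z · f) · γ) γ)
      (ℕ.+-mono-≤ (distance-rotate p f γ x≢y z≢y)
        (distance-sorting p γ inverse steps (rotate x y z · f)
          (unique-resp-↭ (prep a (step-↭ step)) uniq) path′))

-- The cycles `pₜ` and `bar s`, and the bound

steps-map : {B : Set} (f : A → B) {xs ys : List A} → xs ⟶[ k ] ys → map f xs ⟶[ k ] map f ys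
steps-map f done        = done
steps-map f (s ◅ steps) = step-map f s ◅ steps-map f steps

pₜ-zero : ∀ n → pₜ n ⟨$⟩ʳ zero ≡ fromℕ n
-- Zero is written as the image of `fromℕ n` under `reverse`, the last entry of the descending
-- cycle.
pₜ-zero n = trans (cong (pₜ n ⟨$⟩ʳ_) (sym (Fin.opposite-involutive {suc n} zero)))
  (fullCycle-last reverse)

pₜ-suc : (i : Fin n) → pₜ n ⟨$⟩ʳ suc i ≡ inject₁ i
pₜ-suc {n} i = trans (cong (pₜ n ⟨$⟩ʳ_) (sym (Fin.opposite-involutive (suc i))))
  (trans (fullCycle-step reverse (opposite i)) (cong inject₁ (Fin.opposite-involutive i)))

pₜ-inverse : (f : Permutation′ (suc n)) →
  Path (f ⟨$⟩ʳ_) zero (map suc (identitySequence n)) zero →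
  ∀ i → pₜ n ⟨$⟩ʳ (f ⟨$⟩ʳ i) ≡ i
pₜ-inverse {n} f p i
  with step , last ← path-tabulate⁻ id
    (subst (λ xs → Path (f ⟨$⟩ʳ_) zero xs zero) (map-tabulate id suc) p)
  -- The path shows that `f` after `pₜ n` is the identity; injectivity of `f` gives the other order.
  = ⟨$⟩ʳ-injective f (inverse (f ⟨$⟩ʳ i))
  where
  inverse : ∀ j → f ⟨$⟩ʳ (pₜ n ⟨$⟩ʳ j) ≡ j
  inverse zero    = trans (cong (f ⟨$⟩ʳ_) (pₜ-zero n)) last
  inverse (suc j) = trans (cong (f ⟨$⟩ʳ_) (pₜ-suc j)) (step j)

-- The map `suc` turns the letters in `Fin n` into nonzero elements of `Fin (suc n)`, as `lift₀`
-- does, and zero becomes the start of the cycle.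
bar-path : (s : Permutation′ n) → Path (bar s ⟨$⟩ʳ_) zero (map suc (oneLine s)) zero
bar-path s = subst (λ xs → Path (bar s ⟨$⟩ʳ_) zero xs zero) (sym (map-tabulate (s ⟨$⟩ʳ_) suc))
  (path-tabulate⁺ (lift₀ s ⟨$⟩ʳ_) (fullCycle-step (lift₀ s)) (fullCycle-last (lift₀ s)))

oneLine-unique : (s : Permutation′ n) → Unique (zero ∷ map suc (oneLine s))
oneLine-unique s =
  All.map⁺ (All.tabulate (λ _ ())) ∷ map⁺ Fin.suc-injective (tabulate⁺ (⟨$⟩ʳ-injective s))

theorem4 : ∀ (n : ℕ) → 1 ≤ n → (s : Permutation′ n) → (γ : Permutation′ (suc n)) →
    (+ (∣ C (pₜ n · bar s · γ) - C γ ∣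
    ⊔ (∣ C-odd (pₜ n · bar s · γ) - C-odd γ ∣
    ⊔ ∣ C-ev (pₜ n · bar s · γ) - C-ev γ ∣))) / 2
    ≤ℚ (+ td s) / 1
-- After cross-multiplication the claim is that the distance is at most `td s * 2`, which a shortest
-- sorting sequence provides.
theorem4 n _ s γ = *≤* (subst₂ ℤ._≤_ (sym (ℤ.*-identityʳ _)) (ℤ.pos-* (td s) 2) (ℤ.+≤+
  (distance-sorting (pₜ n) γ pₜ-inverse (steps-map suc (td-reached s)) (bar s)
    (oneLine-unique s) (bar-path s))))
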